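{- Let $\phi$ be a finite conjunction of xor-clauses. If $\phi$ is tree-like, then $\phi$ is UP-deducible.
   Context: **Xor-clauses.** Variables are propositional. An xor-clause is an expression $l_1\oplus\dots\oplus l_n$ of literals ($\oplus$ is exclusive or), where constants $\top$ (true), $\bot$ (false) may also occur. It is satisfied by a total truth assignment iff an odd number of its literals are true. Xor-clauses are always taken in normal form: $\neg A$ is rewritten as $A\oplus\top$ and pairs $A\oplus A$ are cancelled, so each atom occurs at most once and only positively. Equivalently, an xor-clause is an equation $x_1\oplus\dots\oplus x_k\equiv p$ with distinct variables $x_1,\dots,x_k$ and $p\in\{\bot,\top\}$ (the xor-clause $x_1\oplus\dots\oplus x_k$ is $x_1\oplus\dots\oplus x_k\equiv\top$, and $x_1\oplus\dots\oplus x_k\oplus\top$ is $x_1\oplus\dots\oplus x_k\equiv\bot$). The literal $x$ is identified with $(x\equiv\top)$ and $\neg x$ with $x\oplus\top$, i.e. $(x\equiv\bot)$. The empty xor-clause $()$ is unsatisfiable and is identified with $\bot$. $\mathrm{vars}(\phi)$ is the set of variables occurring in $\phi$, and $\mathrm{lits}(\phi)=\{x,\neg x\mid x\in\mathrm{vars}(\phi)\}$. $\models$ denotes logical consequence. **UP-derivations.** $C[A/D]$ denotes the normal form of the xor-clause obtained from $C$ by replacing the atom $A$ by $D$. The system UP has two inference rules, for a variable $x$ and an xor-clause $C$: from $x$ and $C$ infer $C[x/\top]$; from $x\oplus\top$ and $C$ infer $C[x/\bot]$. A UP-derivation from a conjunction $\psi$ of xor-clauses is a finite sequence of xor-clauses,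 each of which is in $\psi$ or is inferred from two earlier ones by one of the rules. $\psi\vdash_{\mathrm{up}}D$ means that $D$ occurs in some UP-derivation from $\psi$. **UP-deducible.** $\phi$ is UP-deducible if for all $k\ge 0$ and all $\tilde l_1,\dots,\tilde l_k,\hat l\in\mathrm{lits}(\phi)$: (i) if $\phi\wedge\tilde l_1\wedge\dots\wedge\tilde l_k$ is unsatisfiable, then $\phi\wedge\tilde l_1\wedge\dots\wedge\tilde l_k\vdash_{\mathrm{up}}\bot$; and (ii) otherwise, $\phi\wedge\tilde l_1\wedge\dots\wedge\tilde l_k\models\hat l$ implies $\phi\wedge\tilde l_1\wedge\dots\wedge\tilde l_k\vdash_{\mathrm{up}}\hat l$. **Tree-like.** The constraint graph of $\phi$ is the bipartite graph whose vertices are the variables in $\mathrm{vars}(\phi)$ and the xor-clauses of $\phi$, with an edge between a variable $x$ and an xor-clause $D$ iff $x$ occurs in $D$ (xor-clause vertices are also labelled by their parity $p$). $\phi$ is tree-like if its constraint graph is a tree or a union of disjoint trees. -}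

module Defs where

open import Data.Bool.Base using (Bool; true; false; _∧_; _xor_; if_then_else_)
open import Data.Fin.Base using (Fin)
open import Data.Fin.Subset using (Subset; ⁅_⁆; _-_) renaming (_∈_ to _∈ₛ_; ⊥ to ∅)
open import Data.Fin.Subset.Properties using () renaming (_∈?_ to _∈ₛ?_)
open import Data.List.Base using (List; []; _∷_; _++_; _∷ʳ_; map; length)
open import Data.List.Membership.Propositional using (_∈_)
open import Data.List.Relation.Unary.All using (All)
open import Data.List.Relation.Unary.Linked using (Linked)
open import Data.List.Relation.Unary.Unique.Propositional using (Unique)
open import Data.Nat.Base using (ℕ; _≤_)
open import Data.Product.Base using (Σ-syntax; ∃-syntax; _×_; _,_; proj₁)
open import Data.Vec.Base using (Vec; foldr′; zipWith; tabulate)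
open import Level using (0ℓ)
open import Relation.Binary.Construct.Closure.ReflexiveTransitive using (Star)
open import Relation.Binary.Core using (Rel)
open import Relation.Binary.PropositionalEquality.Core using (_≡_)
open import Relation.Nullary.Decidable.Core using (does)
open import Relation.Nullary.Negation.Core using (¬_)
open import Relation.Unary using (Pred)

private
  variable
    n : ℕ

-- S ≡ₓ p is the xor-clause  x₁ ⊕ … ⊕ xₖ ≡ p  in normal form, where
-- S = {x₁, …, xₖ} is a set of propositional variables drawn from Fin n.
-- Normal forms are canonical: equal clauses are propositionally equal.
infix 6 _≡ₓ_
record XorClause (n : ℕ) : Set where
  constructor _≡ₓ_
  field
    atoms  : Subset n
    parity : Bool

open XorClause public

-- The empty xor-clause ().
⊥ₓ : XorClause n
⊥ₓ = ∅ ≡ₓ true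

-- The literals x and ¬x are (x , true) and (x , false).
Literal : ℕ → Set
Literal n = Fin n × Bool

-- x is x ≡ ⊤, and ¬x is x ⊕ ⊤, i.e. x ≡ ⊥.
unit : Literal n → XorClause n
unit (x , b) = ⁅ x ⁆ ≡ₓ b

-- A finite conjunction; order and repetitions are irrelevant, since it is
-- only ever accessed through list membership.
Formula : ℕ → Set
Formula n = List (XorClause n)

infixl 5 _∧ₗ_
_∧ₗ_ : Formula n → List (Literal n) → Formula n
φ ∧ₗ ls = φ ++ map unit ls

infix 4 _∈vars_ _∈lits_
_∈vars_ : Fin n → Formula n → Set
x ∈vars φ = ∃[ D ] D ∈ φ × x ∈ₛ atoms D

_∈lits_ : Literal n → Formula n → Set
l ∈lits φ = proj₁ l ∈vars φ

------------------------------------------------------------------------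
-- Semantics

Assignment : ℕ → Set
Assignment n = Fin n → Bool

-- The exclusive or of the values τ x over x ∈ S.
⨁ : Assignment n → Subset n → Bool
⨁ τ S = foldr′ _xor_ false (zipWith _∧_ S (tabulate τ))

infix 4 _⊨ᶜ_ _⊨ᶠ_ _⊨_
_⊨ᶜ_ : Assignment n → XorClause n → Set
τ ⊨ᶜ C = ⨁ τ (atoms C) ≡ parity C

_⊨ᶠ_ : Assignment n → Formula n → Set
τ ⊨ᶠ φ = All (τ ⊨ᶜ_) φ

Satisfiable : Formula n → Set
Satisfiable φ = ∃[ τ ] τ ⊨ᶠ φ

Unsatisfiable : Formula n → Set
Unsatisfiable φ = ¬ Satisfiable φ

_⊨_ : Formula n → XorClause n → Set
φ ⊨ C = ∀ τ → τ ⊨ᶠ φ → τ ⊨ᶜ C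

------------------------------------------------------------------------
-- UP-derivations

-- If x occurs in C, then replacing it by the constant b turns
-- x ⊕ R ≡ p  into  b ⊕ R ≡ p,  whose normal form is  R ≡ p ⊕ b.
infix 7 _[_/_]
_[_/_] : XorClause n → Fin n → Bool → XorClause n
C [ x / b ] =
  if does (x ∈ₛ? atoms C) then (atoms C - x) ≡ₓ (parity C xor b) else C

-- UPRule P C D: from the premises P and C infer D.
data UPRule {n : ℕ} : XorClause n → XorClause n → XorClause n → Set where
  ⊕-unit⁺ : ∀ x C → UPRule (unit (x , true))  C (C [ x / true ])
  ⊕-unit⁻ : ∀ x C → UPRule (unit (x , false)) C (C [ x / false ])

-- Derivations are finite sequences, stored with the latest clause first.
data UPDerivation {n : ℕ} (ψ : Formula n) : List (XorClause n) → Set where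
  []    : UPDerivation ψ []
  axiom : ∀ {Ds D} → D ∈ ψ →
          UPDerivation ψ Ds → UPDerivation ψ (D ∷ Ds)
  infer : ∀ {Ds P C D} → P ∈ Ds → C ∈ Ds → UPRule P C D →
          UPDerivation ψ Ds → UPDerivation ψ (D ∷ Ds)

infix 4 _⊢up_
_⊢up_ : Formula n → XorClause n → Set
ψ ⊢up D = ∃[ Ds ] UPDerivation ψ Ds × D ∈ Ds

UPDeducible : Formula n → Set
UPDeducible {n} φ =
  (ls : List (Literal n)) (l̂ : Literal n) → All (_∈lits φ) ls → l̂ ∈lits φ →
    (Unsatisfiable (φ ∧ₗ ls) → φ ∧ₗ ls ⊢up ⊥ₓ)
  × (¬ Unsatisfiable (φ ∧ₗ ls) → φ ∧ₗ ls ⊨ unit l̂ → φ ∧ₗ ls ⊢up unit l̂)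

------------------------------------------------------------------------
-- Graphs and trees

-- Graphs whose vertices form a subset of A.  Edges are a relation on A; the
-- constraint graph below is symmetric and relates only vertices.
record Graph (A : Set) : Set₁ where
  field
    IsVertex : Pred A 0ℓ
    Edge     : Rel A 0ℓ

open Graph public

module _ {A : Set} where

  Connected : Graph A → Set
  Connected G = ∀ u v → IsVertex G u → IsVertex G v → Star (Edge G) u v

  -- v, vs is a simple cycle of length at least 3.
  IsCycle : Graph A → A → List A → Set
  IsCycle G v vs =
    2 ≤ length vs × Unique (v ∷ vs) × Linked (Edge G) (v ∷ vs ∷ʳ v)

  Acyclic : Graph A → Set
  Acyclic G = ∀ v vs → ¬ IsCycle G v vs

  IsTree : Graph A → Set
  IsTree G = Connected G × Acyclic G

  Part : Graph A → (A → ℕ) → ℕ → Graph A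
  Part G part i = record
    { IsVertex = λ v → IsVertex G v × part v ≡ i
    ; Edge     = λ u v → Edge G u v × part u ≡ i × part v ≡ i
    }

  -- The vertices are partitioned into parts with no edges between different
  -- parts, each nonempty part being a tree.  The case of a single tree is
  -- that of a constant map, and the empty graph is the empty union.
  IsDisjointUnionOfTrees : Graph A → Set
  IsDisjointUnionOfTrees G =
    Σ[ part ∈ (A → ℕ) ]
      (∀ u v → Edge G u v → part u ≡ part v)
    × (∀ v → IsVertex G v → IsTree (Part G part (part v)))

data Node (n : ℕ) : Set where
  var    : Fin n → Node n
  clause : XorClause n → Node n

data IsNode {n : ℕ} (φ : Formula n) : Node n → Set where
  var    : ∀ {x} → x ∈vars φ → IsNode φ (var x)
  clause : ∀ {D} → D ∈ φ → IsNode φ (clause D)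

data Occurs {n : ℕ} (φ : Formula n) : Node n → Node n → Set where
  var-clause : ∀ {x D} → D ∈ φ → x ∈ₛ atoms D → Occurs φ (var x) (clause D)
  clause-var : ∀ {x D} → D ∈ φ → x ∈ₛ atoms D → Occurs φ (clause D) (var x)

constraintGraph : Formula n → Graph (Node n)
constraintGraph φ = record { IsVertex = IsNode φ ; Edge = Occurs φ }

TreeLike : Formula n → Set
TreeLike φ = IsDisjointUnionOfTrees (constraintGraph φ)

{-# OPTIONS --safe #-}

-- Unit propagation from φ ∧ l̃₁ ∧ … ∧ l̃ₖ either reaches ⊥ or stops with a set U
-- of unassigned variables such that every clause is already satisfied or still
-- contains two variables of U.  In the latter case every assignment to the
-- propagated variables and to one further variable y extends to a model: among
-- the clauses still open, acyclicity yields a variable z ∈ U other than y that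
-- occurs in a single clause D (follow a path from y until it cannot be
-- prolonged); satisfy the other clauses recursively, and then choose the value
-- of z so that D holds.  So no literal over U is implied.
module Submission where

open import Data.Bool.Base using (Bool; true; false; _xor_; not)
open import Data.Bool.Properties using (xor-assoc; xor-comm; xor-same; xor-identityʳ; not-¬)
  renaming (_≟_ to _≟ᵇ_)
open import Data.Fin.Base using (Fin; zero; suc)
open import Data.Fin.Properties using (_≟_)
open import Data.Fin.Subset using (Subset; ⁅_⁆; _-_; _∩_; ∁; ∣_∣; Nonempty; ⊤)
  renaming (_∈_ to _∈ₛ_; _∉_ to _∉ₛ_; ⊥ to ∅)
open import Data.Fin.Subset.Properties using (Empty-unique; nonempty?; ∈⊤; x∈⁅x⁆;
  x∈⁅y⁆⇒x≡y; ⊆-antisym; x∈∁p⇒x∉p; x∉p⇒x∈∁p; x∈p∩q⁺; x∈p∩q⁻; p─q⊆p; p─⊥≡p; x∈p∧x≢y⇒x∈p-y;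
  x∈p⇒∣p-x∣<∣p∣)
  renaming (_∈?_ to _∈ₛ?_)
open import Data.List.Base using (List; []; _∷_; _++_; _∷ʳ_; length; filter)
open import Data.List.Membership.Propositional using (_∈_; _∉_; find; lose)
open import Data.List.Membership.Propositional.Properties using (∈-∃++; ∈-filter⁺;
  ∈-filter⁻; ∈-++⁺ˡ; ∈-++⁺ʳ; ∈-++⁻; ∈-map⁻)
open import Data.List.Properties using (filter-notAll)
open import Data.List.Relation.Unary.All using (All; []; _∷_; lookup)
  renaming (tabulate to All-tabulate)
open import Data.List.Relation.Unary.All.Properties using (¬Any⇒All¬; ++⁻ˡ; ++⁻ʳ)
open import Data.List.Relation.Unary.AllPairs using ([]; _∷_)
open import Data.List.Relation.Unary.Any using (here; there; any?)
open import Data.List.Relation.Unary.Linked using (Linked; []; [-]; _∷_)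
open import Data.List.Relation.Unary.Unique.Propositional using (Unique)
open import Data.Nat.Base using (ℕ; _<_; z≤n; s≤s)
open import Data.Nat.Induction using (<-wellFounded)
open import Data.Product.Base using (∃-syntax; _×_; _,_; proj₁; proj₂)
open import Data.Sum.Base using (_⊎_; inj₁; inj₂; [_,_]′)
open import Data.Vec.Base using ([]; _∷_; here; there)
open import Data.Vec.Functional using (updateAt)
open import Data.Vec.Functional.Properties using (updateAt-updates; updateAt-minimal)
open import Data.Vec.Properties using (≡-dec)
open import Function.Base using (const; _∘_)
open import Induction.WellFounded using (Acc; acc)
open import Relation.Binary.Definitions using (DecidableEquality)
open import Relation.Binary.PropositionalEquality using (_≡_; _≢_; refl; sym; trans; cong;
  cong₂; subst; ≢-sym; module ≡-Reasoning)
open import Relation.Nullary.Decidable using (yes; no; ¬?; _×-dec_; map′; decidable-stable)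
open import Relation.Nullary.Negation using (¬_; contradiction)
open import Relation.Unary using (Decidable)

open import Defs

private
  variable
    n : ℕ

-- Finite subsets and decidability of clause equality

x∉p-x : (p : Subset n) (x : Fin n) → x ∉ₛ p - x
x∉p-x (_ ∷ p) zero    ()
x∉p-x (_ ∷ p) (suc x) (there x∈) = x∉p-x p x x∈

x∈p-y⇒x∈p : (p : Subset n) {x y : Fin n} → x ∈ₛ p - y → x ∈ₛ p
x∈p-y⇒x∈p p {y = y} = p─q⊆p p ⁅ y ⁆

x∈p-y⇒x≢y : (p : Subset n) {x y : Fin n} → x ∈ₛ p - y → x ≢ y
x∈p-y⇒x≢y p x∈p-y refl = x∉p-x p _ x∈p-y

x∈p∧p-x-empty⇒p≡⁅x⁆ : {p : Subset n} {x : Fin n} →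
                      x ∈ₛ p → ¬ Nonempty (p - x) → p ≡ ⁅ x ⁆
x∈p∧p-x-empty⇒p≡⁅x⁆ {p = p} {x} x∈p ¬ne = ⊆-antisym p⊆ ⊆p
  where
  p⊆ : ∀ {y} → y ∈ₛ p → y ∈ₛ ⁅ x ⁆
  p⊆ {y} y∈p with y ≟ x
  ... | yes refl = x∈⁅x⁆ x
  ... | no  y≢x  = contradiction (y , x∈p∧x≢y⇒x∈p-y y∈p y≢x) ¬ne

  ⊆p : ∀ {y} → y ∈ₛ ⁅ x ⁆ → y ∈ₛ p
  ⊆p y∈ = subst (_∈ₛ p) (sym (x∈⁅y⁆⇒x≡y x y∈)) x∈p

HasTwo : Subset n → Set
HasTwo S = ∃[ x ] ∃[ y ] x ≢ y × x ∈ₛ S × y ∈ₛ S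

other : {S : Subset n} → HasTwo S → (z : Fin n) → ∃[ w ] w ≢ z × w ∈ₛ S
other (x , y , x≢y , x∈S , y∈S) z with x ≟ z
... | yes refl = y , ≢-sym x≢y , y∈S
... | no  x≢z  = x , x≢z , x∈S

_≟ₓ_ : DecidableEquality (XorClause n)
(S ≡ₓ p) ≟ₓ (T ≡ₓ q) =
  map′ (λ (eq₁ , eq₂) → cong₂ _≡ₓ_ eq₁ eq₂)
       (λ eq → cong atoms eq , cong parity eq)
       (≡-dec _≟ᵇ_ S T ×-dec p ≟ᵇ q)

avoids? : (z : Fin n) → Decidable (λ (E : XorClause n) → z ∉ₛ atoms E)
avoids? z E = ¬? (z ∈ₛ? atoms E)

-- Semantics of xor-clauses

xor-cancelˡ : ∀ a b → a xor (a xor b) ≡ b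
xor-cancelˡ a b = trans (sym (xor-assoc a a b)) (cong (_xor b) (xor-same a))

⨁-cong : {τ τ′ : Assignment n} (S : Subset n) →
         (∀ {x} → x ∈ₛ S → τ x ≡ τ′ x) → ⨁ τ S ≡ ⨁ τ′ S
⨁-cong []          eq = refl
⨁-cong (true  ∷ S) eq = cong₂ _xor_ (eq here) (⨁-cong S (eq ∘ there))
⨁-cong (false ∷ S) eq = ⨁-cong S (eq ∘ there)

⨁-∅ : (τ : Assignment n) → ⨁ τ ∅ ≡ false
⨁-∅ {ℕ.zero}  τ = refl
⨁-∅ {ℕ.suc n} τ = ⨁-∅ (τ ∘ suc)

⨁-⁅⁆ : (τ : Assignment n) (x : Fin n) → ⨁ τ ⁅ x ⁆ ≡ τ x
⨁-⁅⁆ τ zero    = trans (cong (τ zero xor_) (⨁-∅ (τ ∘ suc))) (xor-identityʳ (τ zero))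
⨁-⁅⁆ τ (suc x) = ⨁-⁅⁆ (τ ∘ suc) x

⨁-remove : (τ : Assignment n) {S : Subset n} {x : Fin n} → x ∈ₛ S →
           ⨁ τ S ≡ τ x xor ⨁ τ (S - x)
⨁-remove τ {true ∷ S} here =
  cong (λ T → τ zero xor ⨁ (τ ∘ suc) T) (sym (p─⊥≡p S))
⨁-remove τ {false ∷ S} (there x∈S) = ⨁-remove (τ ∘ suc) x∈S
⨁-remove τ {true ∷ S} {suc x} (there x∈S) = begin
  t xor ⨁ τ′ S           ≡⟨ cong (t xor_) (⨁-remove τ′ x∈S) ⟩
  t xor (τ′ x xor r)     ≡⟨ sym (xor-assoc t (τ′ x) r) ⟩
  (t xor τ′ x) xor r     ≡⟨ cong (_xor r) (xor-comm t (τ′ x)) ⟩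
  (τ′ x xor t) xor r     ≡⟨ xor-assoc (τ′ x) t r ⟩
  τ′ x xor (t xor r)     ∎
  where
  open ≡-Reasoning
  t  = τ zero
  τ′ = τ ∘ suc
  r  = ⨁ τ′ (S - x)

⊨ᶜ-subst⁺ : {τ : Assignment n} (C : XorClause n) (x : Fin n) →
            τ ⊨ᶜ C → τ ⊨ᶜ C [ x / τ x ]
⊨ᶜ-subst⁺ {τ = τ} C x τ⊨C with x ∈ₛ? atoms C
... | no  _   = τ⊨C
... | yes x∈C = begin
  ⨁ τ (atoms C - x)                       ≡⟨ sym (xor-cancelˡ (τ x) _) ⟩
  τ x xor (τ x xor ⨁ τ (atoms C - x))     ≡⟨ cong (τ x xor_) (sym (⨁-remove τ x∈C)) ⟩
  τ x xor ⨁ τ (atoms C)                   ≡⟨ cong (τ x xor_) τ⊨C ⟩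
  τ x xor parity C                        ≡⟨ xor-comm (τ x) (parity C) ⟩
  parity C xor τ x                        ∎
  where open ≡-Reasoning

⊨ᶜ-subst⁻ : {τ : Assignment n} (C : XorClause n) (x : Fin n) →
            τ ⊨ᶜ C [ x / τ x ] → τ ⊨ᶜ C
⊨ᶜ-subst⁻ {τ = τ} C x τ⊨ with x ∈ₛ? atoms C
... | no  _   = τ⊨
... | yes x∈C = begin
  ⨁ τ (atoms C)                 ≡⟨ ⨁-remove τ x∈C ⟩
  τ x xor ⨁ τ (atoms C - x)     ≡⟨ cong (τ x xor_) τ⊨ ⟩
  τ x xor (parity C xor τ x)    ≡⟨ cong (τ x xor_) (xor-comm (parity C) (τ x)) ⟩
  τ x xor (τ x xor parity C)    ≡⟨ xor-cancelˡ (τ x) (parity C) ⟩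
  parity C                      ∎
  where open ≡-Reasoning

atoms-subst : (C : XorClause n) {x : Fin n} (b : Bool) → x ∈ₛ atoms C →
              atoms (C [ x / b ]) ≡ atoms C - x
atoms-subst C {x} b x∈C with x ∈ₛ? atoms C
... | yes _   = refl
... | no  x∉C = contradiction x∈C x∉C

-- UP-derivations

-- A unit premise true under `τ` says that the substituted constant is `τ x`, so `⊨ᶜ-subst⁺` covers
-- both rules.
UPRule-sound : {τ : Assignment n} {P C D : XorClause n} → UPRule P C D → τ ⊨ᶜ P → τ ⊨ᶜ C → τ ⊨ᶜ D
UPRule-sound {τ = τ} (⊕-unit⁺ x C) τ⊨P τ⊨C =
  subst (λ b → τ ⊨ᶜ C [ x / b ]) (trans (sym (⨁-⁅⁆ τ x)) τ⊨P) (⊨ᶜ-subst⁺ C x τ⊨C)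
UPRule-sound {τ = τ} (⊕-unit⁻ x C) τ⊨P τ⊨C =
  subst (λ b → τ ⊨ᶜ C [ x / b ]) (trans (sym (⨁-⁅⁆ τ x)) τ⊨P) (⊨ᶜ-subst⁺ C x τ⊨C)

module _ {ψ : Formula n} where

  _++ᵈ_ : ∀ {Ds Es} → UPDerivation ψ Ds → UPDerivation ψ Es → UPDerivation ψ (Ds ++ Es)
  []               ++ᵈ e = e
  axiom D∈ψ d      ++ᵈ e = axiom D∈ψ (d ++ᵈ e)
  infer P∈ C∈ r d  ++ᵈ e = infer (∈-++⁺ˡ P∈) (∈-++⁺ˡ C∈) r (d ++ᵈ e)

  ⊢up-axiom : ∀ {D} → D ∈ ψ → ψ ⊢up D
  ⊢up-axiom D∈ψ = _ , axiom D∈ψ [] , here refl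

  ⊢up-infer : ∀ {P C D} → UPRule P C D → ψ ⊢up P → ψ ⊢up C → ψ ⊢up D
  ⊢up-infer r (Ds , d , P∈) (Es , e , C∈) =
    _ , infer (∈-++⁺ˡ P∈) (∈-++⁺ʳ Ds C∈) r (d ++ᵈ e) , here refl

  ⊢up-subst : ∀ {x b C} → ψ ⊢up unit (x , b) → ψ ⊢up C → ψ ⊢up C [ x / b ]
  ⊢up-subst {b = true}  = ⊢up-infer (⊕-unit⁺ _ _)
  ⊢up-subst {b = false} = ⊢up-infer (⊕-unit⁻ _ _)

  UPDerivation-sound : ∀ {τ : Assignment n} {Ds} → τ ⊨ᶠ ψ → UPDerivation ψ Ds → All (τ ⊨ᶜ_) Ds
  UPDerivation-sound τ⊨ψ []                = []
  UPDerivation-sound τ⊨ψ (axiom D∈ψ d)     = lookup τ⊨ψ D∈ψ ∷ UPDerivation-sound τ⊨ψ d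
  UPDerivation-sound τ⊨ψ (infer P∈ C∈ r d) =
    let ih = UPDerivation-sound τ⊨ψ d in UPRule-sound r (lookup ih P∈) (lookup ih C∈) ∷ ih

  ⊢up-⊥ₓ⇒Unsatisfiable : ψ ⊢up ⊥ₓ → Unsatisfiable ψ
  ⊢up-⊥ₓ⇒Unsatisfiable (_ , d , ⊥∈) (τ , τ⊨ψ) =
    contradiction (trans (sym (⨁-∅ τ)) (lookup (UPDerivation-sound τ⊨ψ d) ⊥∈)) λ ()

-- Saturation under unit propagation

-- A state of unit propagation consists of a set U of unassigned variables and
-- an assignment τ, of which only the values outside U are meaningful.
Settled : Subset n → Assignment n → XorClause n → Set
Settled U τ C = (∀ {x} → x ∈ₛ atoms C → x ∉ₛ U) × τ ⊨ᶜ C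

Open : Subset n → XorClause n → Set
Open U C = HasTwo (atoms C ∩ U)

SettledOrOpen : Subset n → Assignment n → XorClause n → Set
SettledOrOpen U τ C = Settled U τ C ⊎ Open U C

module _ (ψ : Formula n) where

  Propagated : Subset n → Assignment n → Set
  Propagated U τ = ∀ {x} → x ∉ₛ U → ψ ⊢up unit (x , τ x)

  Progress : Subset n → Set
  Progress U = ψ ⊢up ⊥ₓ ⊎ (∃[ x ] ∃[ b ] x ∈ₛ U × ψ ⊢up unit (x , b))

  module _ {U : Subset n} {τ : Assignment n} where

    -- Restoring an atom `x` outside `U` together with its value `τ x` changes neither which atoms
    -- lie in `U` nor the truth under `τ`.
    SettledOrOpen-subst : ∀ {C x} → x ∈ₛ atoms C → x ∉ₛ U →
      SettledOrOpen U τ (C [ x / τ x ]) → SettledOrOpen U τ C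
    SettledOrOpen-subst {C} {x} x∈C x∉U (inj₁ (settled , τ⊨)) =
      inj₁ (settled′ , ⊨ᶜ-subst⁻ C x τ⊨)
      where
      settled′ : ∀ {y} → y ∈ₛ atoms C → y ∉ₛ U
      settled′ {y} y∈C with y ≟ x
      ... | yes refl = x∉U
      ... | no  y≢x  = settled (subst (y ∈ₛ_) (sym (atoms-subst C (τ x) x∈C))
                                      (x∈p∧x≢y⇒x∈p-y y∈C y≢x))
    SettledOrOpen-subst {C} {x} x∈C x∉U (inj₂ (y , z , y≢z , y∈ , z∈)) =
      inj₂ (y , z , y≢z , weaken y∈ , weaken z∈)
      where
      weaken : ∀ {y} → y ∈ₛ atoms (C [ x / τ x ]) ∩ U → y ∈ₛ atoms C ∩ U
      weaken {y} y∈ with x∈p∩q⁻ (atoms (C [ x / τ x ])) U y∈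
      ... | y∈C′ , y∈U =
        x∈p∩q⁺ (x∈p-y⇒x∈p (atoms C) (subst (y ∈ₛ_) (atoms-subst C (τ x) x∈C) y∈C′) , y∈U)

    -- Case distinction on the number of atoms, all unassigned here: none makes the clause settled
    -- or `⊥ₓ`, exactly one makes it a new unit, and two or more leave it open.
    propagate-reduced : ∀ C → (∀ {x} → x ∈ₛ atoms C → x ∈ₛ U) → ψ ⊢up C →
                        SettledOrOpen U τ C ⊎ Progress U
    propagate-reduced C C⊆U ⊢C with nonempty? (atoms C)
    propagate-reduced (S ≡ₓ p) C⊆U ⊢C | no ¬ne with refl ← Empty-unique ¬ne | p
    -- An empty clause of parity true is `⊥ₓ`; one of parity false holds under every assignment.
    ... | true  = inj₂ (inj₁ ⊢C)
    ... | false = inj₁ (inj₁ ((λ x∈ → contradiction (_ , x∈) ¬ne) , ⨁-∅ τ))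
    propagate-reduced C C⊆U ⊢C | yes (x , x∈C) with nonempty? (atoms C - x)
    ... | yes (y , y∈) = inj₁ (inj₂ (x , y , ≢-sym (x∈p-y⇒x≢y (atoms C) y∈)
                               , x∈p∩q⁺ (x∈C , C⊆U x∈C) , x∈p∩q⁺ (y∈C , C⊆U y∈C)))
      where y∈C = x∈p-y⇒x∈p (atoms C) y∈
    ... | no ¬ne = inj₂ (inj₂ (x , parity C , C⊆U x∈C ,
      subst (λ S → ψ ⊢up S ≡ₓ parity C) (x∈p∧p-x-empty⇒p≡⁅x⁆ x∈C ¬ne) ⊢C))

    -- Each atom outside `U` has a derived unit, so it can be substituted away by a UP inference.
    -- The clause shrinks until only atoms of `U` remain, and its status is then carried back to
    -- `C`.
    propagate : Propagated U τ → ∀ C → Acc _<_ ∣ atoms C ∣ → ψ ⊢up C →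
                SettledOrOpen U τ C ⊎ Progress U
    propagate prop C (acc rec) ⊢C with nonempty? (atoms C ∩ ∁ U)
    ... | no ¬ne = propagate-reduced C C⊆U ⊢C
      where
      C⊆U : ∀ {x} → x ∈ₛ atoms C → x ∈ₛ U
      C⊆U {x} x∈C = decidable-stable (x ∈ₛ? U) λ x∉U →
        ¬ne (x , x∈p∩q⁺ (x∈C , x∉p⇒x∈∁p x∉U))
    ... | yes (x , x∈) with x∈C , x∈∁U ← x∈p∩q⁻ (atoms C) (∁ U) x∈ =
      [ inj₁ ∘ SettledOrOpen-subst x∈C x∉U , inj₂ ]′
        (propagate prop (C [ x / τ x ]) (rec smaller) (⊢up-subst (prop x∉U) ⊢C))
      where
      x∉U = x∈∁p⇒x∉p x∈∁U
      smaller : ∣ atoms (C [ x / τ x ]) ∣ < ∣ atoms C ∣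
      smaller = subst (λ S → ∣ S ∣ < ∣ atoms C ∣) (sym (atoms-subst C (τ x) x∈C))
                      (x∈p⇒∣p-x∣<∣p∣ x∈C)

    propagate-all : Propagated U τ → ∀ χ → (∀ {C} → C ∈ χ → C ∈ ψ) →
                    All (SettledOrOpen U τ) χ ⊎ Progress U
    propagate-all prop []      χ⊆ψ = inj₁ []
    propagate-all prop (C ∷ χ) χ⊆ψ
      with propagate prop C (<-wellFounded _) (⊢up-axiom (χ⊆ψ (here refl)))
         | propagate-all prop χ (χ⊆ψ ∘ there)
    ... | inj₂ progress | _             = inj₂ progress
    ... | inj₁ _        | inj₂ progress = inj₂ progress
    ... | inj₁ C-done   | inj₁ χ-done   = inj₁ (C-done ∷ χ-done)

  Saturated : Set
  Saturated = ∃[ U ] ∃[ τ ] Propagated U τ × All (SettledOrOpen U τ) ψ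

  -- Every newly derived unit removes its variable from `U`, so the process ends.
  saturate-from : ∀ U τ → Acc _<_ ∣ U ∣ → Propagated U τ → ψ ⊢up ⊥ₓ ⊎ Saturated
  saturate-from U τ (acc rec) prop with propagate-all prop ψ (λ C∈ → C∈)
  ... | inj₁ done          = inj₂ (U , τ , prop , done)
  ... | inj₂ (inj₁ ⊢⊥)     = inj₁ ⊢⊥
  ... | inj₂ (inj₂ (x , b , x∈U , ⊢unit)) =
    saturate-from (U - x) τ′ (rec (x∈p⇒∣p-x∣<∣p∣ x∈U)) prop′
    where
    τ′ = updateAt τ x (const b)
    prop′ : Propagated (U - x) τ′
    prop′ {y} y∉ with y ≟ x
    ... | yes refl = subst (λ c → ψ ⊢up unit (x , c)) (sym (updateAt-updates x τ)) ⊢unit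
    ... | no  y≢x  = subst (λ c → ψ ⊢up unit (y , c)) (sym (updateAt-minimal y x τ y≢x))
                       (prop λ y∈U → y∉ (x∈p∧x≢y⇒x∈p-y y∈U y≢x))

  saturate : ψ ⊢up ⊥ₓ ⊎ Saturated
  -- At the start every variable is unassigned, so the values of `const false` carry no meaning.
  saturate = saturate-from ⊤ (const false) (<-wellFounded _) (λ x∉⊤ → contradiction ∈⊤ x∉⊤)

-- Paths in acyclic graphs

module _ {A : Set} where

  -- Moves the far end of a path to the front, which is the form in which `IsCycle` lists the
  -- vertices of the closed path.
  Unique-rotate : ∀ xs {v : A} {ys} → Unique (xs ++ v ∷ ys) → Unique (v ∷ xs)
  Unique-rotate []       _            = [] ∷ []
  Unique-rotate (x ∷ xs) (x≢ ∷ uniq) with Unique-rotate xs uniq | ++⁻ʳ xs x≢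
  ... | v≢ ∷ uniq′ | x≢v ∷ _ = (≢-sym x≢v ∷ v≢) ∷ ++⁻ˡ xs x≢ ∷ uniq′

  Linked-prefix : ∀ {R : A → A → Set} xs {v ys} → Linked R (xs ++ v ∷ ys) → Linked R (xs ∷ʳ v)
  Linked-prefix []           _         = [-]
  Linked-prefix (x ∷ [])     (r ∷ _)   = r ∷ [-]
  Linked-prefix (x ∷ y ∷ xs) (r ∷ rs)  = r ∷ Linked-prefix (y ∷ xs) rs

  IsPath : Graph A → List A → Set
  IsPath G vs = Unique vs × Linked (Edge G) vs

  -- If `v` occurred further down the path, the new edge would close the section up to `v` into a
  -- cycle. Since `v` differs from `u` and `w`, that cycle has at least three vertices.
  path-extend : ∀ {G : Graph A} → Acyclic G → ∀ {v u w vs} →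
                v ≢ u → v ≢ w → Edge G v u → IsPath G (u ∷ w ∷ vs) → IsPath G (v ∷ u ∷ w ∷ vs)
  path-extend {G} acyclic {v} {u} {w} {vs} v≢u v≢w e (uniq , linked) =
    (v≢u ∷ v≢w ∷ ¬Any⇒All¬ vs v∉vs) ∷ uniq , e ∷ linked
    where
    v∉vs : v ∉ vs
    v∉vs v∈vs with ps , qs , refl ← ∈-∃++ v∈vs =
      acyclic v (u ∷ w ∷ ps)
        ( s≤s (s≤s z≤n)
        , Unique-rotate (u ∷ w ∷ ps) uniq
        , e ∷ Linked-prefix (u ∷ w ∷ ps) linked)

-- No edge leaves a part, so a cycle lies entirely in the part of its first vertex, which is a tree.
TreeLike⇒Acyclic : (φ : Formula n) → TreeLike φ → Acyclic (constraintGraph φ)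
TreeLike⇒Acyclic φ (part , same , trees) v vs (2≤ , uniq , linked) =
  proj₂ (trees v (isNode vs linked)) v vs (2≤ , uniq , restrict linked refl)
  where
  source-isNode : ∀ {u w} → Occurs φ u w → IsNode φ u
  source-isNode (var-clause D∈φ x∈D) = var (_ , D∈φ , x∈D)
  source-isNode (clause-var D∈φ _)   = clause D∈φ

  isNode : ∀ vs → Linked (Occurs φ) (v ∷ vs ∷ʳ v) → IsNode φ v
  isNode []      (e ∷ _) = source-isNode e
  isNode (_ ∷ _) (e ∷ _) = source-isNode e

  restrict : ∀ {i u us} → Linked (Occurs φ) (u ∷ us) → part u ≡ i →
             Linked (Edge (Part (constraintGraph φ) part i)) (u ∷ us)
  restrict [-]      _  = [-]
  restrict (e ∷ es) eq = (e , eq , eq′) ∷ restrict es eq′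
    where eq′ = trans (sym (same _ _ e)) eq

-- Extending partial assignments

module _ (φ : Formula n) (acyclic : Acyclic (constraintGraph φ)) (U : Subset n) where

  Leaf : Formula n → Fin n → XorClause n → Set
  Leaf χ z D = D ∈ χ × z ∈ₛ atoms D × z ∈ₛ U × (∀ {E} → E ∈ χ → z ∈ₛ atoms E → E ≡ D)

  module _ (χ : Formula n) (χ⊆φ : ∀ {D} → D ∈ χ → D ∈ φ)
           (χ-open : ∀ {D} → D ∈ χ → Open U D) where

    next-variable : ∀ {D} → D ∈ χ → ∀ z → ∃[ w ] w ≢ z × w ∈ₛ atoms D × w ∈ₛ U
    next-variable {D} D∈χ z with w , w≢z , w∈ ← other (χ-open D∈χ) z =
      w , w≢z , x∈p∩q⁻ (atoms D) U w∈

    -- Terminates because acyclicity makes every new variable w fresh, hence an element of W.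
    walk : ∀ {root z D vs} (W : Subset n) → Acc _<_ ∣ W ∣ →
           (∀ {x} → x ∉ₛ W → var x ∈ var z ∷ clause D ∷ vs) →
           D ∈ χ → z ∈ₛ atoms D → z ∈ₛ U → var root ∈ vs →
           IsPath (constraintGraph φ) (var z ∷ clause D ∷ vs) →
           ∃[ z′ ] ∃[ D′ ] z′ ≢ root × Leaf χ z′ D′
    walk {root} {z} {D} {vs} W (acc rec) visited D∈χ z∈D z∈U root∈vs path
      with any? (λ E → z ∈ₛ? atoms E ×-dec ¬? (E ≟ₓ D)) χ
    ... | no ¬other = z , D , z≢root , D∈χ , z∈D , z∈U , unique
      where
      z≢root : z ≢ root
      -- The root lies in the tail of a path without repetitions that starts at `z`.
      z≢root refl with (_ ∷ z≢vs) ∷ _ ← proj₁ path = lookup z≢vs root∈vs refl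
      unique : ∀ {E} → E ∈ χ → z ∈ₛ atoms E → E ≡ D
      unique {E} E∈χ z∈E = decidable-stable (E ≟ₓ D) λ E≢D → ¬other (lose E∈χ (z∈E , E≢D))
    ... | yes another
      with E , E∈χ , z∈E , E≢D ← find another
      with w , w≢z , w∈E , w∈U ← next-variable E∈χ z =
      walk (W - w) (rec (x∈p⇒∣p-x∣<∣p∣ w∈W)) visited′ E∈χ w∈E w∈U
           (there (there root∈vs)) path″
      where
      path′ : IsPath (constraintGraph φ) (clause E ∷ var z ∷ clause D ∷ vs)
      -- The walk does not turn back: the new clause `E` differs from the previous clause `D`, and
      -- likewise `w` from `z` in the next extension.
      path′ = path-extend {G = constraintGraph φ} acyclic (λ ()) (λ { refl → E≢D refl })
                (clause-var (χ⊆φ E∈χ) z∈E) path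

      path″ : IsPath (constraintGraph φ) (var w ∷ clause E ∷ var z ∷ clause D ∷ vs)
      path″ = path-extend {G = constraintGraph φ} acyclic (λ ()) (λ { refl → w≢z refl })
                (var-clause (χ⊆φ E∈χ) w∈E) path′

      w∈W : w ∈ₛ W
      w∈W = decidable-stable (w ∈ₛ? W) λ w∉W → revisits w∉W (proj₁ path″)
        where
        revisits : w ∉ₛ W → ¬ Unique (var w ∷ clause E ∷ var z ∷ clause D ∷ vs)
        revisits w∉W ((_ ∷ w≢) ∷ _) = lookup w≢ (visited w∉W) refl

      visited′ : ∀ {x} → x ∉ₛ W - w → var x ∈ var w ∷ clause E ∷ var z ∷ clause D ∷ vs
      visited′ {x} x∉ with x ≟ w
      ... | yes refl = here refl
      ... | no  x≢w  = there (there (visited λ x∈W → x∉ (x∈p∧x≢y⇒x∈p-y x∈W x≢w)))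

    walk-from : ∀ {root D} → D ∈ χ → root ∈ₛ atoms D → ∃[ z ] ∃[ E ] z ≢ root × Leaf χ z E
    walk-from {root} {D} D∈χ root∈D with w , w≢root , w∈D , w∈U ← next-variable D∈χ root =
      walk ⊤ (<-wellFounded _) (λ x∉⊤ → contradiction ∈⊤ x∉⊤) D∈χ w∈D w∈U (here refl)
        ( ((λ ()) ∷ (λ { refl → w≢root refl }) ∷ []) ∷ ((λ ()) ∷ []) ∷ [] ∷ []
        , var-clause (χ⊆φ D∈χ) w∈D ∷ clause-var (χ⊆φ D∈χ) root∈D ∷ [-])

    leaf : ∀ {D} → D ∈ χ → ∀ y → ∃[ z ] ∃[ E ] z ≢ y × Leaf χ z E
    leaf {D} D∈χ y with any? (λ E → y ∈ₛ? atoms E) χ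
    ... | yes y-occurs with E , E∈χ , y∈E ← find y-occurs = walk-from E∈χ y∈E
    -- If `y` does not occur in `χ`, a walk from any variable of `D` will do: the leaf it finds
    -- occurs in `χ`, hence differs from `y`.
    ... | no ¬y-occurs
      with x , _ , _ , x∈ , _ ← χ-open D∈χ
      with z , E , _ , z-leaf@(E∈χ , z∈E , _) ← walk-from D∈χ (proj₁ (x∈p∩q⁻ (atoms D) U x∈)) =
      z , E , (λ { refl → ¬y-occurs (lose E∈χ z∈E) }) , z-leaf

  -- Induction on the number of clauses. The leaf `z` lies in `U` and differs from `y`, so each step
  -- changes only a value inside `U - y`.
  extend : ∀ χ → Acc _<_ (length χ) → (∀ {D} → D ∈ χ → D ∈ φ) → (∀ {D} → D ∈ χ → Open U D) →
           ∀ y (τ : Assignment n) →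
           ∃[ τ′ ] (∀ {D} → D ∈ χ → τ′ ⊨ᶜ D) × (∀ {x} → x ∉ₛ U - y → τ′ x ≡ τ x)
  extend []          _         _   _      y τ = τ , (λ ()) , (λ _ → refl)
  extend χ@(_ ∷ _) (acc rec) χ⊆φ χ-open y τ
    with z , D , z≢y , D∈χ , z∈D , z∈U , unique ← leaf χ χ⊆φ χ-open (here refl) y
    -- Dropping the clauses that contain `z` drops `D` with all its repetitions and nothing else, by
    -- `unique`.
    with τ₁ , τ₁⊨ , agrees ← extend (filter (avoids? z) χ)
           (rec (filter-notAll (avoids? z) χ (lose D∈χ (λ z∉D → z∉D z∈D))))
           (χ⊆φ ∘ proj₁ ∘ ∈-filter⁻ (avoids? z)) (χ-open ∘ proj₁ ∘ ∈-filter⁻ (avoids? z)) y τ =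
    τ₂ , τ₂⊨ , agrees₂
    where
    -- The rest of `D` has value `r`, so `r xor parity D` is the value of `z` that makes `D` true.
    r  = ⨁ τ₁ (atoms D - z)
    τ₂ = updateAt τ₁ z (const (r xor parity D))

    τ₂⊨D : τ₂ ⊨ᶜ D
    τ₂⊨D = begin
      ⨁ τ₂ (atoms D)                 ≡⟨ ⨁-remove τ₂ z∈D ⟩
      τ₂ z xor ⨁ τ₂ (atoms D - z)    ≡⟨ cong₂ _xor_ (updateAt-updates z τ₁)
                                          (⨁-cong (atoms D - z) λ {x} x∈ →
                                            updateAt-minimal x z τ₁ (x∈p-y⇒x≢y (atoms D) x∈)) ⟩
      (r xor parity D) xor r         ≡⟨ xor-comm (r xor parity D) r ⟩
      r xor (r xor parity D)         ≡⟨ xor-cancelˡ r (parity D) ⟩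
      parity D                       ∎
      where open ≡-Reasoning

    τ₂⊨ : ∀ {E} → E ∈ χ → τ₂ ⊨ᶜ E
    τ₂⊨ {E} E∈χ with z ∈ₛ? atoms E
    ... | yes z∈E = subst (τ₂ ⊨ᶜ_) (sym (unique E∈χ z∈E)) τ₂⊨D
    ... | no  z∉E = trans
      (⨁-cong (atoms E) λ {x} x∈E → updateAt-minimal x z τ₁ λ { refl → z∉E x∈E })
      (τ₁⊨ (∈-filter⁺ (avoids? z) E∈χ z∉E))

    agrees₂ : ∀ {x} → x ∉ₛ U - y → τ₂ x ≡ τ x
    agrees₂ {x} x∉ = trans
      (updateAt-minimal x z τ₁ λ { refl → x∉ (x∈p∧x≢y⇒x∈p-y z∈U z≢y) })
      (agrees x∉)

-- Models of saturated states and UP-deducibility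

¬Open-unit : {U : Subset n} (l : Literal n) → ¬ Open U (unit l)
¬Open-unit {U = U} (x , _) (y , z , y≢z , y∈ , z∈) = y≢z (trans (is-x y∈) (sym (is-x z∈)))
  where
  is-x : ∀ {w} → w ∈ₛ ⁅ x ⁆ ∩ U → w ≡ x
  is-x w∈ = x∈⁅y⁆⇒x≡y x (proj₁ (x∈p∩q⁻ ⁅ x ⁆ U w∈))

-- Only clauses with a variable in `U` are passed to `extend`; settled clauses keep their truth
-- because `τ′` agrees with `τ` outside `U`. Allowing any `τ₀` that agrees with `τ` there leaves the
-- value of a `y` in `U` free.
extend-saturated : (φ : Formula n) → Acyclic (constraintGraph φ) → (ls : List (Literal n)) →
  ∀ {U τ} → All (SettledOrOpen U τ) (φ ∧ₗ ls) →
  ∀ y τ₀ → (∀ {x} → x ∉ₛ U → τ₀ x ≡ τ x) → ∃[ τ′ ] τ′ ⊨ᶠ φ ∧ₗ ls × τ′ y ≡ τ₀ y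
extend-saturated {n} φ acyclic ls {U} {τ} status y τ₀ τ₀≈τ =
  τ′ , All-tabulate τ′⊨ , τ′≈τ₀ (x∉p-x U y)
  where
  touched? : Decidable (λ (C : XorClause n) → Nonempty (atoms C ∩ U))
  touched? C = nonempty? (atoms C ∩ U)

  touched⇒Open : ∀ {C} → C ∈ filter touched? φ → Open U C
  touched⇒Open {C} C∈
    with C∈φ , (x , x∈) ← ∈-filter⁻ touched? {xs = φ} C∈
    with lookup status (∈-++⁺ˡ C∈φ)
  ... | inj₂ C-open        = C-open
  ... | inj₁ (settled , _)
    with x∈C , x∈U ← x∈p∩q⁻ (atoms C) U x∈ = contradiction x∈U (settled x∈C)

  extension = extend φ acyclic U (filter touched? φ) (<-wellFounded _)
                     (proj₁ ∘ ∈-filter⁻ touched?) touched⇒Open y τ₀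

  τ′ : Assignment n
  τ′ = proj₁ extension

  τ′≈τ₀ : ∀ {x} → x ∉ₛ U - y → τ′ x ≡ τ₀ x
  τ′≈τ₀ = proj₂ (proj₂ extension)

  τ′⊨ : ∀ {C} → C ∈ φ ∧ₗ ls → τ′ ⊨ᶜ C
  τ′⊨ {C} C∈ with lookup status C∈
  ... | inj₁ (settled , τ⊨C) = trans
    (⨁-cong (atoms C) λ x∈C →
      trans (τ′≈τ₀ (settled x∈C ∘ x∈p-y⇒x∈p U)) (τ₀≈τ (settled x∈C)))
    τ⊨C
  ... | inj₂ C-open@(x , _ , _ , x∈ , _) with ∈-++⁻ φ C∈
  ...   | inj₁ C∈φ = proj₁ (proj₂ extension) (∈-filter⁺ touched? C∈φ (x , x∈))
  -- An added literal has a single atom and so is never open: every open clause comes from `φ`.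
  ...   | inj₂ C∈ls
        with l , _ , refl ← ∈-map⁻ unit C∈ls = contradiction C-open (¬Open-unit l)

theorem1 : (n : ℕ) (φ : Formula n) → TreeLike φ → UPDeducible φ
theorem1 n φ tree-like ls (y , b) _ _ with saturate (φ ∧ₗ ls)
... | inj₁ ⊢⊥ =
  (λ _ → ⊢⊥) , (λ ¬unsat _ → contradiction (⊢up-⊥ₓ⇒Unsatisfiable ⊢⊥) ¬unsat)
... | inj₂ (U , τ , prop , status) = refute , deduce
  where
  model : ∀ τ₀ → (∀ {x} → x ∉ₛ U → τ₀ x ≡ τ x) → ∃[ τ′ ] τ′ ⊨ᶠ φ ∧ₗ ls × τ′ y ≡ τ₀ y
  model = extend-saturated φ (TreeLike⇒Acyclic φ tree-like) ls status y

  refute : Unsatisfiable (φ ∧ₗ ls) → φ ∧ₗ ls ⊢up ⊥ₓ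
  refute unsat with τ′ , τ′⊨ , _ ← model τ (λ _ → refl) = contradiction (τ′ , τ′⊨) unsat

  forced : φ ∧ₗ ls ⊨ unit (y , b) → ∀ τ₀ → (∀ {x} → x ∉ₛ U → τ₀ x ≡ τ x) → τ₀ y ≡ b
  forced entails τ₀ τ₀≈τ with τ′ , τ′⊨ , eq ← model τ₀ τ₀≈τ =
    trans (sym eq) (trans (sym (⨁-⁅⁆ τ′ y)) (entails τ′ τ′⊨))

  deduce : ¬ Unsatisfiable (φ ∧ₗ ls) → φ ∧ₗ ls ⊨ unit (y , b) → φ ∧ₗ ls ⊢up unit (y , b)
  deduce _ entails with y ∈ₛ? U
  -- The propagated value `τ y` must be `b`, so the unit already derived for `y` is the required
  -- literal.
  ... | no  y∉U = subst (λ c → φ ∧ₗ ls ⊢up unit (y , c)) (forced entails τ (λ _ → refl)) (prop y∉U)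
  ... | yes y∈U = contradiction
    (trans (sym (forced entails τ₀ τ₀≈τ)) (updateAt-updates y τ)) (not-¬ refl)
    where
    -- For `y` in `U` the opposite value also extends to a model, which refutes the entailment.
    τ₀ = updateAt τ y (const (not b))
    τ₀≈τ : ∀ {x} → x ∉ₛ U → τ₀ x ≡ τ x
    τ₀≈τ {x} x∉U = updateAt-minimal x y τ λ { refl → x∉U y∈U }
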